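{- For every integer $n>0$, the polynomial $\Phi(n;t)\in\mathbb{Z}[t]$ is a $3$-special polynomial.
   Context: Let $f_1=1$, $f_2=2$ and $f_i=f_{i-1}+f_{i-2}$ for $i>2$ be the Fibonacci numbers (with this indexing). A Fibonacci partition of a positive integer $n$ is a representation of $n$ as an unordered sum of distinct Fibonacci numbers $f_i$ ($i\geqslant 1$), called the parts of the partition. Let $\Phi_h(n)$ be the number of Fibonacci partitions of $n$ with exactly $h$ parts, and set $$\Phi(n;t):=\sum_{h>0}\Phi_h(n)t^h.$$ Let $K:=\mathbb{Z}[T]/(T^3-1)$. For $g(t)=\sum_{h\geqslant 0}a_ht^h\in\mathbb{Z}[t]$ and $i\in\{0,1,2\}$ put $R_i(g(t)):=\sum_{h\equiv i \bmod 3}a_h$, and define $R:\mathbb{Z}[t]\to K$ by $R(g(t)):=R_0(g(t))+R_1(g(t))T+R_2(g(t))T^2$. An element $a+bT+cT^2\in K$ (with $a,b,c\in\mathbb{Z}$) is called special if either $a=b=c$, or $|a-b|+|a-c|+|b-c|=2$. A polynomial $g(t)\in\mathbb{Z}[t]$ is called $3$-special if $R(g(t))$ is a special element of $K$. -}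

module Defs where

open import Data.Nat as ℕ using (ℕ; zero; suc; _≤_; _<_; _>_; z≤n; s≤s; _%_)
open import Data.Nat.ListAction using (sum)
import Data.Nat.Properties as ℕₚ
open import Data.Integer as ℤ using (ℤ; +_; 0ℤ; ∣_∣)
import Data.Integer.Properties as ℤₚ
open import Data.Fin using (Fin; toℕ)
open import Data.Fin.Patterns using (0F; 1F; 2F)
open import Data.Empty using (⊥-elim)
open import Data.List using (List; []; _∷_; _++_; map; filter; length; foldr; upTo; applyUpTo)
import Data.List.Properties as Listₚ
open import Data.List.Membership.Propositional using (_∈_; _∉_)
open import Data.List.Membership.Propositional.Properties
  using (∈-map⁺; ∈-map⁻; ∈-++⁺ˡ; ∈-++⁺ʳ; ∈-++⁻; ∈-filter⁺; ∈-filter⁻)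
open import Data.List.Relation.Unary.All as All using (All; []; _∷_)
import Data.List.Relation.Unary.All.Properties as Allₚ
open import Data.List.Relation.Unary.AllPairs as AllPairs using (AllPairs; []; _∷_)
open import Data.List.Relation.Unary.Any using (here)
open import Data.List.Relation.Unary.Unique.Propositional using (Unique)
import Data.List.Relation.Unary.Unique.Propositional.Properties as Uniqueₚ
open import Data.Product using (_×_; _,_; proj₁; proj₂; ∃; ∃-syntax)
open import Data.Sum using (_⊎_; inj₁; inj₂)
open import Function using (_∘_)
open import Function.Bundles using (_⇔_; mk⇔)
open import Relation.Binary.PropositionalEquality
open import Relation.Nullary using (yes; no)

-- The recurrence is run one step backwards, to f 0 = 1, so that f 2 = 2 is
-- an instance of it.  The index 0 is excluded in IsFibonacci below.
f : ℕ → ℕ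
f 0             = 1
f 1             = 1
f (suc (suc i)) = f (suc i) ℕ.+ f i

IsFibonacci : ℕ → Set
IsFibonacci m = ∃[ i ] 1 ≤ i × f i ≡ m

-- An unordered sum of distinct parts is encoded by listing the parts in
-- strictly decreasing order.
record IsFibonacciPartition (n : ℕ) (ps : List ℕ) : Set where
  constructor isFibonacciPartition
  field
    decreasing : AllPairs _>_ ps
    fibonacci  : All IsFibonacci ps
    sums-to    : sum ps ≡ n

sublists : ∀ {A : Set} → List A → List (List A)
sublists []       = [] ∷ []
sublists (x ∷ xs) = map (x ∷_) (sublists xs) ++ sublists xs

-- f k , … , f 2 , f 1
fibonacciDownFrom : ℕ → List ℕ
fibonacciDownFrom zero    = []
fibonacciDownFrom (suc k) = f (suc k) ∷ fibonacciDownFrom k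

-- Since i ≤ f i, only f 1 , … , f n can be parts of a partition of n.
-- That this list is exact is ∈-fibonacciPartitions and
-- fibonacciPartitions-unique below.
fibonacciPartitions : ℕ → List (List ℕ)
fibonacciPartitions n = filter (λ ps → sum ps ℕ.≟ n) (sublists (fibonacciDownFrom n))

Φₕ : ℕ → ℕ → ℕ
Φₕ h n = length (filter (λ ps → length ps ℕ.≟ h) (fibonacciPartitions n))

-- Coefficient lists, constant term first; trailing zeros are allowed.
ℤ[t] : Set
ℤ[t] = List ℤ

coeff : ℤ[t] → ℕ → ℤ
coeff []      _       = 0ℤ
coeff (a ∷ g) zero    = a
coeff (a ∷ g) (suc h) = coeff g h

-- Φₕ h n vanishes for h > n, so the sum over h > 0 stops at h = n
-- (see coeff-Φ below).
Φ : ℕ → ℤ[t]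
Φ n = 0ℤ ∷ applyUpTo (λ h → + Φₕ (suc h) n) n

-- K = ℤ[T]/(T³ - 1) as a setoid: polynomials in T, with p ≈ₖ q when
-- p - q = (T³ - 1) · r for some polynomial r.
K : Set
K = ℤ[t]

infix 4 _≈ₖ_
_≈ₖ_ : K → K → Set
p ≈ₖ q = ∃[ r ] ∀ i →
  coeff p i ℤ.- coeff q i ≡ coeff (0ℤ ∷ 0ℤ ∷ 0ℤ ∷ r) i ℤ.- coeff r i

infix 5 _+_T+_T²
_+_T+_T² : ℤ → ℤ → ℤ → K
a + b T+ c T² = a ∷ b ∷ c ∷ []

Rᵢ : Fin 3 → ℤ[t] → ℤ
Rᵢ i g = foldr ℤ._+_ 0ℤ
  (map (coeff g) (filter (λ h → h % 3 ℕ.≟ toℕ i) (upTo (length g))))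

R : ℤ[t] → K
R g = Rᵢ 0F g + Rᵢ 1F g T+ Rᵢ 2F g T²

-- The a, b, c here are determined by x: see representative-unique below.
Special : K → Set
Special x = ∃[ a ] ∃[ b ] ∃[ c ] (x ≈ₖ a + b T+ c T²) ×
  ((a ≡ b × b ≡ c) ⊎ ∣ a ℤ.- b ∣ ℕ.+ ∣ a ℤ.- c ∣ ℕ.+ ∣ b ℤ.- c ∣ ≡ 2)

3-Special : ℤ[t] → Set
3-Special g = Special (R g)

f>0 : ∀ i → 0 < f i
f>0 0             = s≤s z≤n
f>0 1             = s≤s z≤n
f>0 (suc (suc i)) = ℕₚ.≤-trans (f>0 (suc i)) (ℕₚ.m≤m+n _ _)

f-step : ∀ i → f i ≤ f (suc i)
f-step zero    = ℕₚ.≤-refl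
f-step (suc i) = ℕₚ.m≤m+n _ _

f-mono′ : ∀ {i j} → i ℕ.≤′ j → f i ≤ f j
f-mono′ (ℕ.≤′-reflexive refl)     = ℕₚ.≤-refl
f-mono′ {j = suc j} (ℕ.≤′-step p) = ℕₚ.≤-trans (f-mono′ p) (f-step j)

f-mono : ∀ {i j} → i ≤ j → f i ≤ f j
f-mono = f-mono′ ∘ ℕₚ.≤⇒≤′

f-strict : ∀ i → f (suc i) < f (suc (suc i))
f-strict i = ℕₚ.m<m+n _ (f>0 i)

i≤fi : ∀ i → i ≤ f i
i≤fi 0             = z≤n
i≤fi 1             = s≤s z≤n
i≤fi (suc (suc i)) = ℕₚ.≤-<-trans (i≤fi (suc i)) (f-strict i)

f-cancel-< : ∀ {i j} → f i < f j → i < j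
f-cancel-< fi<fj = ℕₚ.≰⇒> λ j≤i → ℕₚ.<⇒≱ fi<fj (f-mono j≤i)

IsFibonacci≤ : ℕ → ℕ → Set
IsFibonacci≤ k m = ∃[ i ] 1 ≤ i × i ≤ k × f i ≡ m

fibonacciDownFrom-fibonacci : ∀ k → All (IsFibonacci≤ k) (fibonacciDownFrom k)
fibonacciDownFrom-fibonacci zero    = []
fibonacciDownFrom-fibonacci (suc k) =
  (suc k , s≤s z≤n , ℕₚ.≤-refl , refl) ∷
  All.map (λ (i , 1≤i , i≤k , e) → i , 1≤i , ℕₚ.m≤n⇒m≤1+n i≤k , e)
    (fibonacciDownFrom-fibonacci k)

fibonacciDownFrom-decreasing : ∀ k → AllPairs _>_ (fibonacciDownFrom k)
fibonacciDownFrom-decreasing zero          = []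
fibonacciDownFrom-decreasing (suc zero)    = [] ∷ []
fibonacciDownFrom-decreasing (suc (suc k)) =
  All.map (λ { (i , _ , i≤k , refl) → ℕₚ.≤-<-trans (f-mono i≤k) (f-strict k) })
    (fibonacciDownFrom-fibonacci (suc k))
  ∷ fibonacciDownFrom-decreasing (suc k)

sublists-All : ∀ {A : Set} {P : A → Set} {xs ys} →
  All P xs → ys ∈ sublists xs → All P ys
sublists-All [] (here refl) = []
sublists-All {xs = x ∷ xs} (p ∷ ps) ys∈ with ∈-++⁻ (map (x ∷_) (sublists xs)) ys∈
... | inj₂ q = sublists-All ps q
... | inj₁ q with ∈-map⁻ (x ∷_) q
...   | _ , zs∈ , refl = p ∷ sublists-All ps zs∈

sublists-AllPairs : ∀ {A : Set} {_~_ : A → A → Set} {xs ys} →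
  AllPairs _~_ xs → ys ∈ sublists xs → AllPairs _~_ ys
sublists-AllPairs [] (here refl) = []
sublists-AllPairs {xs = x ∷ xs} (p ∷ ps) ys∈ with ∈-++⁻ (map (x ∷_) (sublists xs)) ys∈
... | inj₂ q = sublists-AllPairs ps q
... | inj₁ q with ∈-map⁻ (x ∷_) q
...   | _ , zs∈ , refl = sublists-All p zs∈ ∷ sublists-AllPairs ps zs∈

sublists-length : ∀ {A : Set} (xs : List A) {ys} → ys ∈ sublists xs → length ys ≤ length xs
sublists-length [] (here refl) = z≤n
sublists-length (x ∷ xs) ys∈ with ∈-++⁻ (map (x ∷_) (sublists xs)) ys∈
... | inj₂ q = ℕₚ.m≤n⇒m≤1+n (sublists-length xs q)
... | inj₁ q with ∈-map⁻ (x ∷_) q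
...   | _ , zs∈ , refl = s≤s (sublists-length xs zs∈)

sublists-unique : ∀ {A : Set} {xs : List A} → Unique xs → Unique (sublists xs)
sublists-unique [] = [] ∷ []
sublists-unique {xs = x ∷ xs} (x∉ ∷ u) =
  Uniqueₚ.++⁺ (Uniqueₚ.map⁺ Listₚ.∷-injectiveʳ (sublists-unique u)) (sublists-unique u)
    λ (p , q) → disjoint p q
  where
  disjoint : ∀ {ys} → ys ∈ map (x ∷_) (sublists xs) → ys ∉ sublists xs
  disjoint p q with ∈-map⁻ (x ∷_) p
  ... | _ , _ , refl = All.head (sublists-All x∉ q) refl

[]∈sublists : ∀ {A : Set} (xs : List A) → [] ∈ sublists xs
[]∈sublists []       = here refl
[]∈sublists (x ∷ xs) = ∈-++⁺ʳ (map (x ∷_) (sublists xs)) ([]∈sublists xs)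

∈-sublists-fibonacci : ∀ k {ps} → AllPairs _>_ ps → All (IsFibonacci≤ k) ps →
  ps ∈ sublists (fibonacciDownFrom k)
∈-sublists-fibonacci k [] [] = []∈sublists (fibonacciDownFrom k)
∈-sublists-fibonacci zero (_ ∷ _) ((_ , s≤s _ , () , _) ∷ _)
∈-sublists-fibonacci (suc k) {x ∷ ps} (x> ∷ d) ((i , 1≤i , i≤k , refl) ∷ fs)
  with ℕₚ.m≤n⇒m<n∨m≡n i≤k
... | inj₂ refl = ∈-++⁺ˡ (∈-map⁺ (x ∷_)
  (∈-sublists-fibonacci k d (All.zipWith
    (λ { (lt , j , 1≤j , _ , refl) → j , 1≤j , ℕₚ.≤-pred (f-cancel-< lt) , refl }) (x> , fs))))
... | inj₁ (s≤s i≤k′) = ∈-++⁺ʳ (map (f (suc k) ∷_) (sublists (fibonacciDownFrom k)))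
  (∈-sublists-fibonacci k (x> ∷ d) ((i , 1≤i , i≤k′ , refl) ∷ All.zipWith
    (λ { (lt , j , 1≤j , _ , refl) →
         j , 1≤j , ℕₚ.≤-trans (ℕₚ.<⇒≤ (f-cancel-< lt)) i≤k′ , refl }) (x> , fs)))

parts≤sum : ∀ ps → All (_≤ sum ps) ps
parts≤sum []       = []
parts≤sum (p ∷ ps) =
  ℕₚ.m≤m+n p _ ∷ All.map (λ q → ℕₚ.≤-trans q (ℕₚ.m≤n+m _ p)) (parts≤sum ps)

∈-fibonacciPartitions : ∀ n ps → ps ∈ fibonacciPartitions n ⇔ IsFibonacciPartition n ps
∈-fibonacciPartitions n ps = mk⇔ to from
  where
  to : ps ∈ fibonacciPartitions n → IsFibonacciPartition n ps
  to ps∈ with ∈-filter⁻ (λ qs → sum qs ℕ.≟ n) {xs = sublists (fibonacciDownFrom n)} ps∈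
  ... | q , e = isFibonacciPartition
    (sublists-AllPairs (fibonacciDownFrom-decreasing n) q)
    (All.map (λ (i , 1≤i , _ , e′) → i , 1≤i , e′)
      (sublists-All (fibonacciDownFrom-fibonacci n) q))
    e

  from : IsFibonacciPartition n ps → ps ∈ fibonacciPartitions n
  from (isFibonacciPartition d fs refl) = ∈-filter⁺ (λ qs → sum qs ℕ.≟ n)
    (∈-sublists-fibonacci n d (All.zipWith
      (λ { (le , i , 1≤i , refl) → i , 1≤i , ℕₚ.≤-trans (i≤fi i) le , refl })
      (parts≤sum ps , fs)))
    refl

fibonacciPartitions-unique : ∀ n → Unique (fibonacciPartitions n)
fibonacciPartitions-unique n = Uniqueₚ.filter⁺ (λ qs → sum qs ℕ.≟ n)
  (sublists-unique (AllPairs.map ℕₚ.>⇒≢ (fibonacciDownFrom-decreasing n)))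

length-fibonacciDownFrom : ∀ k → length (fibonacciDownFrom k) ≡ k
length-fibonacciDownFrom zero    = refl
length-fibonacciDownFrom (suc k) = cong suc (length-fibonacciDownFrom k)

Φₕ-vanishes : ∀ {h n} → n < h → Φₕ h n ≡ 0
Φₕ-vanishes {h} {n} n<h = cong length (Listₚ.filter-none (λ ps → length ps ℕ.≟ h)
  (All.tabulate λ {ps} ps∈ e → ℕₚ.<⇒≱ n<h (subst₂ _≤_ e (length-fibonacciDownFrom n)
    (sublists-length (fibonacciDownFrom n)
      (proj₁ (∈-filter⁻ (λ qs → sum qs ℕ.≟ n) {xs = sublists (fibonacciDownFrom n)} ps∈))))))

coeff-applyUpTo : ∀ (g : ℕ → ℤ) n h → (n ≤ h → g h ≡ 0ℤ) → coeff (applyUpTo g n) h ≡ g h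
coeff-applyUpTo g zero    h       z = sym (z z≤n)
coeff-applyUpTo g (suc n) zero    z = refl
coeff-applyUpTo g (suc n) (suc h) z = coeff-applyUpTo (g ∘ suc) n h (z ∘ s≤s)

coeff-Φ : ∀ n h → 0 < h → coeff (Φ n) h ≡ + Φₕ h n
coeff-Φ n (suc h) _ =
  coeff-applyUpTo (λ h → + Φₕ (suc h) n) n h (λ n≤h → cong +_ (Φₕ-vanishes (s≤s n≤h)))

coeff-beyond : ∀ g i → length g ≤ i → coeff g i ≡ 0ℤ
coeff-beyond []      i       _       = refl
coeff-beyond (a ∷ g) (suc i) (s≤s p) = coeff-beyond g i p

representative-unique : ∀ {a b c a′ b′ c′} →
  (a + b T+ c T²) ≈ₖ (a′ + b′ T+ c′ T²) → a ≡ a′ × b ≡ b′ × c ≡ c′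
representative-unique (r , e) = low _ _ _ (e 0) , low _ _ _ (e 1) , low _ _ _ (e 2)
  where
  periodic : ∀ i → coeff r i ≡ coeff r (3 ℕ.+ i)
  periodic i = ℤₚ.i-j≡0⇒i≡j _ _ (sym (e (3 ℕ.+ i)))

  vanish : ∀ m i → length r ≤ m ℕ.+ i → coeff r i ≡ 0ℤ
  vanish zero    i p = coeff-beyond r i p
  vanish (suc m) i p = trans (periodic i) (vanish m (3 ℕ.+ i)
    (ℕₚ.≤-trans p (ℕₚ.≤-trans (ℕₚ.≤-reflexive (sym (ℕₚ.+-suc m i)))
      (ℕₚ.+-monoʳ-≤ m (ℕₚ.m≤n+m (suc i) 2)))))

  low : ∀ i x y → x ℤ.- y ≡ 0ℤ ℤ.- coeff r i → x ≡ y
  low i x y eq = ℤₚ.i-j≡0⇒i≡j x y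
    (trans eq (cong (λ z → 0ℤ ℤ.- z) (vanish (length r) i (ℕₚ.m≤m+n _ i))))

{-# OPTIONS --safe #-}
module Submission where

-- An element of K is special iff its image in ℤ[ω] = K/(1 + T + T²) is 0 or a
-- unit, so it suffices to evaluate Φ n at a primitive cube root of unity ω.
-- Let P k n be the coefficient of xⁿ in the product of 1 + ω x^(f i) over
-- 1 ≤ i ≤ k.  Since f 1 + … + f k < f (k + 2), the triple
-- (P k n , P k (f (k + 1) + n) , P k (f k + n)) for n < f (k + 1) arises from such
-- a triple at k - 1 by one of two linear maps, according to whether the greedy
-- expansion of n omits or uses f k.  Starting from (1 , 0 , 0), these maps
-- reach only finitely many triples, all with first entry 0 or a unit.

open import Defs
open import Data.Nat using (ℕ; _>_)
open import Data.Bool using (true; false; if_then_else_)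
open import Data.Fin.Patterns using (0F; 1F; 2F)
open import Data.Integer as ℤ using (ℤ; +_; -_; 0ℤ; 1ℤ; -1ℤ; ∣_∣)
import Data.Integer.Properties as ℤₚ
open import Data.Integer.Tactic.RingSolver using (solve-∀)
open import Data.List using (List; []; _∷_; _++_; map; filter; length; foldr; upTo;
  applyUpTo; cartesianProductWith)
import Data.List.Membership.DecPropositional as DecMembership
open import Data.List.Membership.Propositional using (_∈_)
open import Data.List.Membership.Propositional.Properties using (∈-filter⁻)
import Data.List.Properties as Listₚ
open import Data.List.Relation.Unary.All as All using (All; []; _∷_)
import Data.List.Relation.Unary.All.Properties as Allₚ
open import Data.List.Relation.Unary.Any using (here)
open import Data.Nat as ℕ using (zero; suc; _≤_; _<_; _%_; z≤n; s≤s; _≡ᵇ_)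
open import Data.Nat.ListAction using (sum)
import Data.Nat.Properties as ℕₚ
open import Data.Product using (_×_; _,_; proj₁; proj₂)
import Data.Product.Properties as ×ₚ
open import Data.Sum as Sum using (_⊎_)
open import Function using (_∘_; id)
open import Relation.Binary.PropositionalEquality
open import Relation.Nullary using (Dec; yes; no; ¬_; does)
open import Relation.Nullary.Decidable using (toWitness; _×-dec_; _⊎-dec_)
open import Relation.Unary using (Decidable)

-- Arithmetic of the Eisenstein integers

-- (p , q) stands for p + q ω, where ω² + ω + 1 = 0.
ℤ[ω] : Set
ℤ[ω] = ℤ × ℤ

infixl 6 _⊕_
_⊕_ : ℤ[ω] → ℤ[ω] → ℤ[ω]
(p , q) ⊕ (p′ , q′) = p ℤ.+ p′ , q ℤ.+ q′

𝟘 𝟙 : ℤ[ω]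
𝟘 = 0ℤ , 0ℤ
𝟙 = 1ℤ , 0ℤ

ω·_ : ℤ[ω] → ℤ[ω]
ω· (p , q) = - q , p ℤ.- q

ω^_ : ℕ → ℤ[ω]
ω^ zero  = 𝟙
ω^ suc h = ω· (ω^ h)

⊕-assoc : ∀ x y z → (x ⊕ y) ⊕ z ≡ x ⊕ (y ⊕ z)
⊕-assoc (p , q) (p′ , q′) (p″ , q″) = cong₂ _,_ (ℤₚ.+-assoc p p′ p″) (ℤₚ.+-assoc q q′ q″)

⊕-identityˡ : ∀ x → 𝟘 ⊕ x ≡ x
⊕-identityˡ (p , q) = cong₂ _,_ (ℤₚ.+-identityˡ p) (ℤₚ.+-identityˡ q)

⊕-identityʳ : ∀ x → x ⊕ 𝟘 ≡ x
⊕-identityʳ (p , q) = cong₂ _,_ (ℤₚ.+-identityʳ p) (ℤₚ.+-identityʳ q)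

⊕-interchange : ∀ x y z w → (x ⊕ y) ⊕ (z ⊕ w) ≡ (x ⊕ z) ⊕ (y ⊕ w)
⊕-interchange (p , q) (p′ , q′) (p″ , q″) (p‴ , q‴) =
  cong₂ _,_ (identity p p′ p″ p‴) (identity q q′ q″ q‴)
  where
  identity : ∀ a b c d → (a ℤ.+ b) ℤ.+ (c ℤ.+ d) ≡ (a ℤ.+ c) ℤ.+ (b ℤ.+ d)
  identity = solve-∀

ω·-distrib-⊕ : ∀ x y → ω· (x ⊕ y) ≡ (ω· x) ⊕ (ω· y)
ω·-distrib-⊕ (p , q) (p′ , q′) = cong₂ _,_ (ℤₚ.neg-distrib-+ q q′) (identity p q p′ q′)
  where
  identity : ∀ p q p′ q′ → (p ℤ.+ p′) ℤ.- (q ℤ.+ q′) ≡ (p ℤ.- q) ℤ.+ (p′ ℤ.- q′)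
  identity = solve-∀

-- Special elements through their value at ω

-- The squared norm of p + q ω is half of (p - q)² + p² + q², so the second
-- case describes the six units.
ZeroOrUnit : ℤ[ω] → Set
ZeroOrUnit (p , q) = (p ≡ 0ℤ × q ≡ 0ℤ) ⊎ ∣ p ℤ.- q ∣ ℕ.+ ∣ p ∣ ℕ.+ ∣ q ∣ ≡ 2

zeroOrUnit? : Decidable ZeroOrUnit
zeroOrUnit? (p , q) =
  ((p ℤ.≟ 0ℤ) ×-dec (q ℤ.≟ 0ℤ)) ⊎-dec (∣ p ℤ.- q ∣ ℕ.+ ∣ p ∣ ℕ.+ ∣ q ∣ ℕ.≟ 2)

-- R g at T = ω, using ω² = - 1 - ω
evalω : ℤ[t] → ℤ[ω]
evalω g = Rᵢ 0F g ℤ.- Rᵢ 2F g , Rᵢ 1F g ℤ.- Rᵢ 2F g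

≈ₖ-refl : ∀ p → p ≈ₖ p
≈ₖ-refl p = [] , λ i → trans (ℤₚ.+-inverseʳ (coeff p i)) (sym (vanishes i))
  where
  vanishes : ∀ i → coeff (0ℤ ∷ 0ℤ ∷ 0ℤ ∷ []) i ℤ.- coeff [] i ≡ 0ℤ
  vanishes 0                   = refl
  vanishes 1                   = refl
  vanishes 2                   = refl
  vanishes (suc (suc (suc i))) = refl

-- The coordinates of `evalω g` are a - c and b - c, and their difference is a - b, so the two
-- disjunctions match case by case.
zeroOrUnit⇒3-Special : ∀ g → ZeroOrUnit (evalω g) → 3-Special g
zeroOrUnit⇒3-Special g z = a , b , c , ≈ₖ-refl (R g) , Sum.map allEqual (trans sameSum) z
  where
  a = Rᵢ 0F g
  b = Rᵢ 1F g
  c = Rᵢ 2F g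

  allEqual : a ℤ.- c ≡ 0ℤ × b ℤ.- c ≡ 0ℤ → a ≡ b × b ≡ c
  allEqual (a-c≡0 , b-c≡0) = trans a≡c (sym b≡c) , b≡c
    where
    a≡c = ℤₚ.i-j≡0⇒i≡j a c a-c≡0
    b≡c = ℤₚ.i-j≡0⇒i≡j b c b-c≡0

  identity : ∀ a b c → a ℤ.- b ≡ (a ℤ.- c) ℤ.- (b ℤ.- c)
  identity = solve-∀

  sameSum : ∣ a ℤ.- b ∣ ℕ.+ ∣ a ℤ.- c ∣ ℕ.+ ∣ b ℤ.- c ∣ ≡
            ∣ (a ℤ.- c) ℤ.- (b ℤ.- c) ∣ ℕ.+ ∣ a ℤ.- c ∣ ℕ.+ ∣ b ℤ.- c ∣
  sameSum = cong (λ d → ∣ d ∣ ℕ.+ ∣ a ℤ.- c ∣ ℕ.+ ∣ b ℤ.- c ∣) (identity a b c)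

-- Evaluation of coefficient lists at ω

-- `filter` consults only `does`, so the two tests may decide different propositions, such as
-- `suc h % 3 ≡ 0` and `h % 3 ≡ 2`.
filter-map : ∀ {A B : Set} {P : B → Set} {Q : A → Set} (P? : Decidable P) (Q? : Decidable Q)
  (g : A → B) → (∀ x → does (P? (g x)) ≡ does (Q? x)) →
  ∀ xs → filter P? (map g xs) ≡ map g (filter Q? xs)
filter-map P? Q? g P≗Q []       = refl
filter-map P? Q? g P≗Q (x ∷ xs) rewrite P≗Q x with does (Q? x)
... | true  = cong (g x ∷_) (filter-map P? Q? g P≗Q xs)
... | false = filter-map P? Q? g P≗Q xs

coeffs-shift : ∀ {P Q : ℕ → Set} (P? : Decidable P) (Q? : Decidable Q) →
  (∀ h → does (P? (suc h)) ≡ does (Q? h)) → ∀ a g →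
  map (coeff (a ∷ g)) (filter P? (applyUpTo suc (length g))) ≡
  map (coeff g) (filter Q? (upTo (length g)))
coeffs-shift P? Q? P≗Q a g = begin
  map (coeff (a ∷ g)) (filter P? (applyUpTo suc n))
    ≡⟨ cong (map (coeff (a ∷ g)) ∘ filter P?) (Listₚ.map-upTo suc n) ⟨
  map (coeff (a ∷ g)) (filter P? (map suc (upTo n)))
    ≡⟨ cong (map (coeff (a ∷ g))) (filter-map P? Q? suc P≗Q (upTo n)) ⟩
  map (coeff (a ∷ g)) (map suc (filter Q? (upTo n)))
    ≡⟨ Listₚ.map-∘ (filter Q? (upTo n)) ⟨
  map (coeff g) (filter Q? (upTo n)) ∎
  where
  open ≡-Reasoning
  n = length g

R₀-∷ : ∀ a g → Rᵢ 0F (a ∷ g) ≡ a ℤ.+ Rᵢ 2F g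
R₀-∷ a g = cong (λ cs → a ℤ.+ foldr ℤ._+_ 0ℤ cs)
  (coeffs-shift (λ h → h % 3 ℕ.≟ 0) (λ h → h % 3 ℕ.≟ 2) shift a g)
  where
  shift : ∀ h → (suc h % 3 ≡ᵇ 0) ≡ (h % 3 ≡ᵇ 2)
  shift 0                   = refl
  shift 1                   = refl
  shift 2                   = refl
  -- `_%_` computes with period three here, so the goal reduces to the one for `h`.
  shift (suc (suc (suc h))) = shift h

R₁-∷ : ∀ a g → Rᵢ 1F (a ∷ g) ≡ Rᵢ 0F g
R₁-∷ a g = cong (foldr ℤ._+_ 0ℤ)
  (coeffs-shift (λ h → h % 3 ℕ.≟ 1) (λ h → h % 3 ℕ.≟ 0) shift a g)
  where
  shift : ∀ h → (suc h % 3 ≡ᵇ 1) ≡ (h % 3 ≡ᵇ 0)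
  shift 0                   = refl
  shift 1                   = refl
  shift 2                   = refl
  shift (suc (suc (suc h))) = shift h

R₂-∷ : ∀ a g → Rᵢ 2F (a ∷ g) ≡ Rᵢ 1F g
R₂-∷ a g = cong (foldr ℤ._+_ 0ℤ)
  (coeffs-shift (λ h → h % 3 ℕ.≟ 2) (λ h → h % 3 ℕ.≟ 1) shift a g)
  where
  shift : ∀ h → (suc h % 3 ≡ᵇ 2) ≡ (h % 3 ≡ᵇ 1)
  shift 0                   = refl
  shift 1                   = refl
  shift 2                   = refl
  shift (suc (suc (suc h))) = shift h

-- Horner's rule: prefixing `a` multiplies by T, which rotates the residue classes, and adds `a` to
-- class 0.
evalω-∷ : ∀ a g → evalω (a ∷ g) ≡ (a , 0ℤ) ⊕ (ω· evalω g)
evalω-∷ a g rewrite R₀-∷ a g | R₁-∷ a g | R₂-∷ a g =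
  cong₂ _,_ (identity₁ a (Rᵢ 1F g) (Rᵢ 2F g)) (identity₂ (Rᵢ 0F g) (Rᵢ 1F g) (Rᵢ 2F g))
  where
  identity₁ : ∀ a y z → a ℤ.+ z ℤ.- y ≡ a ℤ.+ - (y ℤ.- z)
  identity₁ = solve-∀
  identity₂ : ∀ x y z → x ℤ.- y ≡ 0ℤ ℤ.+ ((x ℤ.- z) ℤ.- (y ℤ.- z))
  identity₂ = solve-∀

applyUpTo-cong : ∀ {A : Set} {c d : ℕ → A} → c ≗ d → ∀ m → applyUpTo c m ≡ applyUpTo d m
applyUpTo-cong c≗d zero    = refl
applyUpTo-cong c≗d (suc m) = cong₂ _∷_ (c≗d 0) (applyUpTo-cong (c≗d ∘ suc) m)

evalω-0 : ∀ m → evalω (applyUpTo (λ _ → 0ℤ) m) ≡ 𝟘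
evalω-0 zero    = refl
evalω-0 (suc m) = trans (evalω-∷ 0ℤ (applyUpTo (λ _ → 0ℤ) m)) (cong (λ x → 𝟘 ⊕ (ω· x)) (evalω-0 m))

evalω-+ : ∀ c d m → evalω (applyUpTo (λ h → c h ℤ.+ d h) m) ≡
  evalω (applyUpTo c m) ⊕ evalω (applyUpTo d m)
evalω-+ c d zero    = refl
evalω-+ c d (suc m) = begin
  evalω (c 0 ℤ.+ d 0 ∷ applyUpTo (λ h → c (suc h) ℤ.+ d (suc h)) m)
    ≡⟨ evalω-∷ (c 0 ℤ.+ d 0) (applyUpTo (λ h → c (suc h) ℤ.+ d (suc h)) m) ⟩
  ((c 0 , 0ℤ) ⊕ (d 0 , 0ℤ)) ⊕ (ω· evalω (applyUpTo (λ h → c (suc h) ℤ.+ d (suc h)) m))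
    ≡⟨ cong (λ x → ((c 0 , 0ℤ) ⊕ (d 0 , 0ℤ)) ⊕ (ω· x)) (evalω-+ (c ∘ suc) (d ∘ suc) m) ⟩
  ((c 0 , 0ℤ) ⊕ (d 0 , 0ℤ)) ⊕ (ω· (C ⊕ D))
    ≡⟨ cong (((c 0 , 0ℤ) ⊕ (d 0 , 0ℤ)) ⊕_) (ω·-distrib-⊕ C D) ⟩
  ((c 0 , 0ℤ) ⊕ (d 0 , 0ℤ)) ⊕ ((ω· C) ⊕ (ω· D))
    ≡⟨ ⊕-interchange (c 0 , 0ℤ) (d 0 , 0ℤ) (ω· C) (ω· D) ⟩
  ((c 0 , 0ℤ) ⊕ (ω· C)) ⊕ ((d 0 , 0ℤ) ⊕ (ω· D))
    ≡⟨ cong₂ _⊕_ (evalω-∷ (c 0) (applyUpTo (c ∘ suc) m)) (evalω-∷ (d 0) (applyUpTo (d ∘ suc) m)) ⟨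
  evalω (applyUpTo c (suc m)) ⊕ evalω (applyUpTo d (suc m)) ∎
  where
  open ≡-Reasoning
  C = evalω (applyUpTo (c ∘ suc) m)
  D = evalω (applyUpTo (d ∘ suc) m)

-- Generating functions by length

-- With `_≡ᵇ_`, `δ (suc l) ∘ suc` computes to `δ l`, which drives the induction in `evalω-δ`.
δ : ℕ → ℕ → ℤ
δ l h = if l ≡ᵇ h then 1ℤ else 0ℤ

evalω-δ : ∀ {l m} → l < m → evalω (applyUpTo (δ l) m) ≡ ω^ l
evalω-δ {zero} {suc m} _ = trans (evalω-∷ 1ℤ (applyUpTo (λ _ → 0ℤ) m)) (cong (λ x → 𝟙 ⊕ (ω· x)) (evalω-0 m))
evalω-δ {suc l} {suc m} (s≤s l<m) = trans (evalω-∷ 0ℤ (applyUpTo (δ l) m))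
  (trans (⊕-identityˡ (ω· evalω (applyUpTo (δ l) m))) (cong ω·_ (evalω-δ l<m)))

weight : ∀ {A : Set} → List (List A) → ℤ[ω]
weight []         = 𝟘
weight (ps ∷ pss) = (ω^ length ps) ⊕ weight pss

weight-++ : ∀ {A : Set} (pss qss : List (List A)) → weight (pss ++ qss) ≡ weight pss ⊕ weight qss
weight-++ []         qss = sym (⊕-identityˡ (weight qss))
weight-++ (ps ∷ pss) qss =
  trans (cong ((ω^ length ps) ⊕_) (weight-++ pss qss)) (sym (⊕-assoc (ω^ length ps) (weight pss) (weight qss)))

weight-map-∷ : ∀ {A : Set} (x : A) pss → weight (map (x ∷_) pss) ≡ ω· weight pss
weight-map-∷ x []         = refl
weight-map-∷ x (ps ∷ pss) = trans (cong ((ω^ suc (length ps)) ⊕_) (weight-map-∷ x pss))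
  (sym (ω·-distrib-⊕ (ω^ length ps) (weight pss)))

count : ∀ {A : Set} → List (List A) → ℕ → ℕ
count pss h = length (filter (λ ps → length ps ℕ.≟ h) pss)

count-∷ : ∀ {A : Set} (ps : List A) pss h → + count (ps ∷ pss) h ≡ δ (length ps) h ℤ.+ + count pss h
count-∷ ps pss h with length ps ≡ᵇ h
... | true  = refl
... | false = refl

-- Each list contributes the monomial t^length, whose value is a power of ω; the bound keeps every
-- such monomial among the first `m` coefficients.
evalω-count : ∀ {A : Set} {m} {pss : List (List A)} → All (λ ps → length ps < m) pss →
  evalω (applyUpTo (λ h → + count pss h) m) ≡ weight pss
evalω-count {m = m} [] = evalω-0 m
evalω-count {m = m} {ps ∷ pss} (p ∷ all) = begin
  evalω (applyUpTo (λ h → + count (ps ∷ pss) h) m)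
    ≡⟨ cong evalω (applyUpTo-cong (count-∷ ps pss) m) ⟩
  evalω (applyUpTo (λ h → δ (length ps) h ℤ.+ + count pss h) m)
    ≡⟨ evalω-+ (δ (length ps)) (λ h → + count pss h) m ⟩
  evalω (applyUpTo (δ (length ps)) m) ⊕ evalω (applyUpTo (λ h → + count pss h) m)
    ≡⟨ cong₂ _⊕_ (evalω-δ p) (evalω-count all) ⟩
  (ω^ length ps) ⊕ weight pss ∎
  where open ≡-Reasoning

-- Coefficients of the partial products

sublistsWithSum : List ℕ → ℕ → List (List ℕ)
sublistsWithSum xs n = filter (λ ps → sum ps ℕ.≟ n) (sublists xs)

-- The coefficient of xⁿ in the product of 1 + ω x^(f i) over 1 ≤ i ≤ k
P : ℕ → ℕ → ℤ[ω]
P k n = weight (sublistsWithSum (fibonacciDownFrom k) n)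

evalω-Φ : ∀ n → n > 0 → evalω (Φ n) ≡ P n n
evalω-Φ n@(suc _) _ = begin
  evalω (Φ n)
    -- `Φ` has a literal zero as constant term; it agrees with `Φₕ 0 n` because the empty list does
    -- not sum to a positive `n`.
    ≡⟨ cong (λ a → evalω (a ∷ applyUpTo (λ h → + Φₕ (suc h) n) n)) (cong +_ Φ₀≡0) ⟨
  evalω (applyUpTo (λ h → + Φₕ h n) (suc n))
    ≡⟨ evalω-count (All.tabulate (s≤s ∘ length≤n)) ⟩
  P n n ∎
  where
  open ≡-Reasoning

  length≤n : ∀ {ps} → ps ∈ fibonacciPartitions n → length ps ≤ n
  length≤n {ps} ps∈ = subst (length ps ≤_) (length-fibonacciDownFrom n)
    (sublists-length (fibonacciDownFrom n) (proj₁ (∈-filter⁻ (λ ps → sum ps ℕ.≟ n) ps∈)))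

  Φ₀≡0 : Φₕ 0 n ≡ 0
  Φ₀≡0 = cong length (Listₚ.filter-none (λ ps → length ps ℕ.≟ 0) (All.map (λ {ps} → nonempty {ps})
    (Allₚ.all-filter (λ ps → sum ps ℕ.≟ n) (sublists (fibonacciDownFrom n)))))
    where
    nonempty : ∀ {ps} → sum ps ≡ n → ¬ length ps ≡ 0
    nonempty {[]}    ()
    nonempty {_ ∷ _} _ ()

sublists-sum-≤ : ∀ xs → All (λ ps → sum ps ≤ sum xs) (sublists xs)
sublists-sum-≤ []       = z≤n ∷ []
sublists-sum-≤ (x ∷ xs) = Allₚ.++⁺
  (Allₚ.map⁺ (All.map (ℕₚ.+-monoʳ-≤ x) (sublists-sum-≤ xs)))
  (All.map (λ p → ℕₚ.≤-trans p (ℕₚ.m≤n+m _ x)) (sublists-sum-≤ xs))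

-- Adding `f (suc k)` to both sides of the bound turns the right side into `f (3 + k)` by the
-- recurrence.
sum-fibonacciDownFrom : ∀ k → sum (fibonacciDownFrom k) < f (2 ℕ.+ k)
sum-fibonacciDownFrom zero    = s≤s z≤n
sum-fibonacciDownFrom (suc k) = subst (sum (fibonacciDownFrom (suc k)) <_)
  (ℕₚ.+-comm (f (suc k)) (f (2 ℕ.+ k))) (ℕₚ.+-monoʳ-< (f (suc k)) (sum-fibonacciDownFrom k))

P-large : ∀ k {n} → f (2 ℕ.+ k) ≤ n → P k n ≡ 𝟘
P-large k {n} le = cong weight (Listₚ.filter-none (λ ps → sum ps ℕ.≟ n)
  (All.map (λ { p refl → ℕₚ.<⇒≱ (ℕₚ.≤-<-trans p (sum-fibonacciDownFrom k)) le })
    (sublists-sum-≤ (fibonacciDownFrom k))))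

-- Sublists are split by whether they contain `f (suc k)`. That part stays added on the left of the
-- test, since `n - f (suc k)` would be truncated for small `n`.
P-suc-filter : ∀ k n → P (suc k) n ≡
  (ω· weight (filter (λ ps → f (suc k) ℕ.+ sum ps ℕ.≟ n) (sublists (fibonacciDownFrom k)))) ⊕ P k n
P-suc-filter k n = begin
  weight (filter sum≟n (map (x ∷_) pss ++ pss))
    ≡⟨ cong weight (Listₚ.filter-++ sum≟n (map (x ∷_) pss) pss) ⟩
  weight (filter sum≟n (map (x ∷_) pss) ++ filter sum≟n pss)
    ≡⟨ weight-++ (filter sum≟n (map (x ∷_) pss)) _ ⟩
  weight (filter sum≟n (map (x ∷_) pss)) ⊕ P k n
    ≡⟨ cong (λ qss → weight qss ⊕ P k n) (filter-map sum≟n (sum≟n ∘ (x ∷_)) (x ∷_) (λ _ → refl) pss) ⟩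
  weight (map (x ∷_) (filter (sum≟n ∘ (x ∷_)) pss)) ⊕ P k n
    ≡⟨ cong (_⊕ P k n) (weight-map-∷ x (filter (sum≟n ∘ (x ∷_)) pss)) ⟩
  (ω· weight (filter (sum≟n ∘ (x ∷_)) pss)) ⊕ P k n ∎
  where
  open ≡-Reasoning
  x     = f (suc k)
  pss   = sublists (fibonacciDownFrom k)
  sum≟n = λ (ps : List ℕ) → sum ps ℕ.≟ n

P-suc-< : ∀ k {n} → n < f (suc k) → P (suc k) n ≡ P k n
P-suc-< k {n} n<f = trans (P-suc-filter k n) (trans
  (cong (λ qss → (ω· weight qss) ⊕ P k n) (Listₚ.filter-none (λ ps → f (suc k) ℕ.+ sum ps ℕ.≟ n)
    (All.universal (λ ps e → ℕₚ.<⇒≱ n<f (subst (f (suc k) ≤_) e (ℕₚ.m≤m+n _ _)))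
      (sublists (fibonacciDownFrom k)))))
  (⊕-identityˡ (P k n)))

P-suc-+ : ∀ k n → P (suc k) (f (suc k) ℕ.+ n) ≡ (ω· P k n) ⊕ P k (f (suc k) ℕ.+ n)
P-suc-+ k n = trans (P-suc-filter k _)
  (cong (λ qss → (ω· weight qss) ⊕ P k (f (suc k) ℕ.+ n))
    (Listₚ.filter-≐ _ (λ ps → sum ps ℕ.≟ n)
      (ℕₚ.+-cancelˡ-≡ (f (suc k)) _ _ , cong (f (suc k) ℕ.+_))
      (sublists (fibonacciDownFrom k))))

-- The linear recursion on triples

-- P k (f k + n) is needed because it enters the recursion for P k (f (suc k) + n).
State : Set
State = ℤ[ω] × ℤ[ω] × ℤ[ω]

state : ℕ → ℕ → State
state k n = P k n , P k (f (suc k) ℕ.+ n) , P k (f k ℕ.+ n)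

skip take : State → State
skip (x , y , z) = x , ω· z , (ω· x) ⊕ y
take (x , y , z) = (ω· x) ⊕ y , 𝟘 , ω· y

state-skip : ∀ k {n} → n < f (suc k) → state (suc k) n ≡ skip (state k n)
state-skip k {n} n<f = cong₂ _,_ (P-suc-< k n<f) (cong₂ _,_ second (P-suc-+ k n))
  where
  open ≡-Reasoning
  second : P (suc k) (f (2 ℕ.+ k) ℕ.+ n) ≡ ω· P k (f k ℕ.+ n)
  second = begin
    P (suc k) (f (2 ℕ.+ k) ℕ.+ n)
      ≡⟨ cong (P (suc k)) (ℕₚ.+-assoc (f (suc k)) (f k) n) ⟩
    P (suc k) (f (suc k) ℕ.+ (f k ℕ.+ n))
      ≡⟨ P-suc-+ k (f k ℕ.+ n) ⟩
    (ω· P k (f k ℕ.+ n)) ⊕ P k (f (suc k) ℕ.+ (f k ℕ.+ n))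
      -- Without `f (suc k)`, the available parts sum to less than `f (2 + k)`.
      ≡⟨ cong ((ω· P k (f k ℕ.+ n)) ⊕_) (P-large k
           (ℕₚ.≤-trans (ℕₚ.m≤m+n _ n) (ℕₚ.≤-reflexive (ℕₚ.+-assoc (f (suc k)) (f k) n)))) ⟩
    (ω· P k (f k ℕ.+ n)) ⊕ 𝟘
      ≡⟨ ⊕-identityʳ (ω· P k (f k ℕ.+ n)) ⟩
    ω· P k (f k ℕ.+ n) ∎

state-take : ∀ k n → state (suc k) (f (suc k) ℕ.+ n) ≡ take (state k n)
state-take k n = cong₂ _,_ (P-suc-+ k n) (cong₂ _,_ second third)
  where
  second : P (suc k) (f (2 ℕ.+ k) ℕ.+ (f (suc k) ℕ.+ n)) ≡ 𝟘
  second = P-large (suc k) (ℕₚ.+-monoʳ-≤ (f (2 ℕ.+ k)) (ℕₚ.m≤m+n _ n))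

  third : P (suc k) (f (suc k) ℕ.+ (f (suc k) ℕ.+ n)) ≡ ω· P k (f (suc k) ℕ.+ n)
  third = trans (P-suc-+ k _) (trans
    -- Twice `f (suc k)` is at least `f (suc k) + f k`, which is out of reach of the smaller parts.
    (cong ((ω· P k (f (suc k) ℕ.+ n)) ⊕_) (P-large k
      (ℕₚ.+-monoʳ-≤ (f (suc k)) (ℕₚ.≤-trans (f-step k) (ℕₚ.m≤m+n _ n)))))
    (⊕-identityʳ (ω· P k (f (suc k) ℕ.+ n))))

-- Finiteness of the orbit

-- The six units ±1, ±ω, ±ω², each given by its action; `id` comes first, so `states` begins with
-- `baseStates`.
units : List (ℤ[ω] → ℤ[ω])
units = id ∷ ω·_ ∷ (λ x → ω· ω· x) ∷ map (neg ∘_) (id ∷ ω·_ ∷ (λ x → ω· ω· x) ∷ [])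
  where
  neg : ℤ[ω] → ℤ[ω]
  neg (p , q) = - p , - q

-- The orbit of (1 , 0 , 0) under skip and take, up to units
baseStates : List State
baseStates =
  (𝟙 , 𝟘 , 𝟘) ∷ (𝟙 , 𝟘 , ω) ∷ (𝟙 , 𝟘 , -𝟙) ∷
  (𝟙 , ω² , 𝟘) ∷ (𝟙 , ω² , ω) ∷ (𝟙 , ω² , -𝟙) ∷
  (𝟙 , -ω , 𝟘) ∷ (𝟙 , -ω , ω) ∷ (𝟙 , -ω , -𝟙) ∷
  (𝟘 , 𝟙 , 𝟘) ∷ (𝟘 , 𝟘 , 𝟙) ∷ (𝟘 , 𝟘 , 𝟘) ∷ []
  where
  ω ω² -𝟙 -ω : ℤ[ω]
  ω  = 0ℤ , 1ℤ
  ω² = -1ℤ , -1ℤ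
  -𝟙 = -1ℤ , 0ℤ
  -ω = 0ℤ , -1ℤ

states : List State
states = cartesianProductWith (λ u (x , y , z) → u x , u y , u z) units baseStates

_≟ω_ : (x y : ℤ[ω]) → Dec (x ≡ y)
_≟ω_ = ×ₚ.≡-dec ℤ._≟_ ℤ._≟_

open DecMembership (×ₚ.≡-dec _≟ω_ (×ₚ.≡-dec _≟ω_ _≟ω_)) using (_∈?_)

-- A finite check by evaluation over the 72 listed triples; listing all unit multiples replaces an
-- argument that `skip` and `take` commute with units.
states-closed : All (λ s → skip s ∈ states × take s ∈ states) states
states-closed = toWitness
  {a? = All.all? (λ s → (skip s ∈? states) ×-dec (take s ∈? states)) states} _

states-zeroOrUnit : All (ZeroOrUnit ∘ proj₁) states
states-zeroOrUnit = toWitness {a? = All.all? (zeroOrUnit? ∘ proj₁) states} _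

-- Induction along the greedy expansion: the part is skipped when it exceeds `n`, and otherwise
-- taken with the remainder passed on.
state∈states : ∀ k {n} → n < f (suc k) → state k n ∈ states
-- The empty product is 1, so this triple is `(𝟙 , 𝟘 , 𝟘)`, the head of `states`.
state∈states zero {zero} _ = here refl
state∈states zero {suc n} (s≤s ())
state∈states (suc k) {n} n<f with n ℕ.<? f (suc k)
... | yes n<f′ = subst (_∈ states) (sym (state-skip k n<f′))
  (proj₁ (All.lookup states-closed (state∈states k n<f′)))
... | no n≮f′ = subst (λ n → state (suc k) n ∈ states) (ℕₚ.m+[n∸m]≡n f≤n)
  (subst (_∈ states) (sym (state-take k m)) (proj₂ (All.lookup states-closed (state∈states k m<f))))
  where
  f≤n = ℕₚ.≮⇒≥ n≮f′
  m   = n ℕ.∸ f (suc k)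
  m<f : m < f (suc k)
  -- Since `f (2 + k)` is `f (suc k) + f k`, the remainder is even below `f k`.
  m<f = ℕₚ.<-≤-trans (ℕₚ.+-cancelˡ-< (f (suc k)) m (f k)
    (subst (_< f (2 ℕ.+ k)) (sym (ℕₚ.m+[n∸m]≡n f≤n)) n<f)) (f-step k)

theorem6 : (n : ℕ) → n > 0 → 3-Special (Φ n)
theorem6 n n>0 = zeroOrUnit⇒3-Special (Φ n) (subst ZeroOrUnit (sym (evalω-Φ n n>0))
  -- `i≤fi (suc n)` unfolds to `n < f (suc n)`, so the triple at `k = n` starts with `P n n`.
  (All.lookup states-zeroOrUnit (state∈states n (i≤fi (suc n)))))
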